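{- Let $A$ be a set with $|A| = k$ and assume that $n \geq k + 2$. If $f \colon A^n \to B$ is totally symmetric, then $f$ is reconstructible.
   Context: $A$ and $B$ are sets with at least two elements; $k$, $n$ are positive integers. $[n] := \{1,\dots,n\}$, $\binom{[n]}{2}$ denotes the set of all $2$-element subsets of $[n]$, and $\Sigma_n$ is the symmetric group on $[n]$. For $\mathbf{a} \in A^n$ and $\sigma \colon [m] \to [n]$, write $\mathbf{a}\sigma := (a_{\sigma(1)},\dots,a_{\sigma(m)}) \in A^m$. Functions $f, g \colon A^n \to B$ are equivalent, $f \equiv g$, if there is $\sigma \in \Sigma_n$ with $f(\mathbf{a}) = g(\mathbf{a}\sigma)$ for all $\mathbf{a} \in A^n$. For $n \geq 2$, $f \colon A^n \to B$ and $I \in \binom{[n]}{2}$, the identification minor $f_I \colon A^{n-1} \to B$ is given by $f_I(\mathbf{a}) = f(\mathbf{a}\delta_I)$, where $\delta_I \colon [n] \to [n-1]$ is defined by $\delta_I(i) = i$ if $i < \max I$, $\delta_I(i) = \min I$ if $i = \max I$, and $\delta_I(i) = i-1$ if $i > \max I$. The deck of $f$, $\operatorname{deck} f$, is the multiset $\{f_I/{\equiv} : I \in \binom{[n]}{2}\}$ of equivalence classes. A function $g \colon A^n \to B$ is a reconstruction of $f$ if $\operatorname{deck} f = \operatorname{deck} g$. The function $f$ is reconstructible if it is equivalent to all of its reconstructions. $f \colon A^n \to B$ is totally symmetric if $f(\mathbf{a}) = f(\mathbf{a}\sigma)$ for all $\mathbf{a} \in A^n$ and all $\sigma \in \Sigma_n$.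 -}

module Defs where

open import Level using (Level; _⊔_)
open import Data.Nat.Base using (ℕ; pred)
open import Data.Nat.Properties using (<-≤-trans)
open import Data.Fin.Base using (Fin; zero; suc; toℕ; fromℕ<; _<_)
open import Data.Fin.Properties using (<-cmp; toℕ≤pred[n])
open import Data.Fin.Permutation using (Permutation′; _⟨$⟩ʳ_)
open import Data.Product.Base using (Σ-syntax; ∃₂)
open import Data.Vec.Base using (Vec; lookup; tabulate)
open import Function.Bundles using (_↔_; Inverse)
open import Relation.Binary.Core using (Rel)
open import Relation.Binary.Definitions using (tri<; tri≈; tri>)
open import Relation.Binary.PropositionalEquality.Core using (_≡_; _≢_)

private
  variable
    a b ℓ i j : Level
    A : Set a
    B : Set b
    m n : ℕ

infixl 7 _⊙_
infix 4 _≈_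

AtLeastTwo : Set a → Set a
AtLeastTwo X = ∃₂ λ (x y : X) → x ≢ y

-- Tuples are `Vec`s rather than functions `Fin n → A`, so that pointwise equal
-- tuples are propositionally equal without function extensionality.
_⊙_ : Vec A n → (Fin m → Fin n) → Vec A m
𝐚 ⊙ σ = tabulate λ i → lookup 𝐚 (σ i)

_≈_ : {A : Set a} {B : Set b} → Rel (Vec A n → B) (a ⊔ b)
_≈_ {n = n} f g = Σ[ σ ∈ Permutation′ n ] ∀ 𝐚 → f 𝐚 ≡ g (𝐚 ⊙ (σ ⟨$⟩ʳ_))

TotallySymmetric : {A : Set a} {B : Set b} → (Vec A n → B) → Set (a ⊔ b)
TotallySymmetric {n = n} f =
  ∀ 𝐚 (σ : Permutation′ n) → f 𝐚 ≡ f (𝐚 ⊙ (σ ⟨$⟩ʳ_))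

-- The two-element subsets {min , max} of `Fin n`, each represented exactly once.
record Pair (n : ℕ) : Set where
  constructor pair
  field
    min max : Fin n
    min<max : min < max

open Pair public

below-max : (I : Pair n) {i : Fin n} → i < max I → Fin (pred n)
below-max I i<max = fromℕ< (<-≤-trans i<max (toℕ≤pred[n] (max I)))

-- The three cases are i < max I, i ≡ max I and i > max I. `below-max` retypes
-- its implicit argument without changing its value, and passing from `suc i` to
-- `i : Fin (pred n)` is subtraction of one.
δ : Pair n → Fin n → Fin (pred n)
δ I i       with <-cmp i (max I)
δ I i       | tri< i<max _ _ = below-max I i<max
δ I i       | tri≈ _ _ _     = below-max I (min<max I)
δ I (suc i) | tri> _ _ _     = i

minor : (Vec A n → B) → Pair n → (Vec A (pred n) → B)
minor f I 𝐚 = f (𝐚 ⊙ δ I)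

-- For a relation _∼_, equality of the multisets {x i / ∼ : i ∈ I} and
-- {y j / ∼ : j ∈ J} of ∼-classes, given as indexed families of representatives:
-- some bijection of the index types matches up related representatives.
MultisetEq : {X : Set a} {I : Set i} {J : Set j} →
             Rel X ℓ → (I → X) → (J → X) → Set (i ⊔ j ⊔ ℓ)
MultisetEq {I = I} {J = J} _∼_ x y =
  Σ[ π ∈ I ↔ J ] ∀ i → x i ∼ y (Inverse.to π i)

-- The deck of f, as the family of representatives I ↦ f_I; decks are to be
-- compared with `MultisetEq _≈_`.
deck : (Vec A n → B) → Pair n → (Vec A (pred n) → B)
deck f = minor f

_IsReconstructionOf_ : {A : Set a} {B : Set b} → Rel (Vec A n → B) (a ⊔ b)
g IsReconstructionOf f = MultisetEq _≈_ (deck f) (deck g)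

Reconstructible : {A : Set a} {B : Set b} → (Vec A n → B) → Set (a ⊔ b)
Reconstructible f = ∀ g → g IsReconstructionOf f → f ≈ g

{-# OPTIONS --safe #-}
-- Identify tuples with multisets of entries, as f is totally symmetric. Reading
-- the deck backwards, every pair i ≠ j has a position q such that, for all tuples
-- b with b i = b j, g b is f of b with one copy of b i replaced by b q. If q lies
-- in {i , j}, then g b = f b. Otherwise, comparing these descriptions of g on
-- tuples that are constant on two different pairs at once yields enough
-- identities of f to conclude f (x x x y …) = f (x x y y …). As n ≥ k + 2, such
-- an f depends only on the set of entries of a tuple with a repeated entry, and
-- so g b = f b again.
module Submission where

open import Level using (Level; _⊔_)
open import Data.Nat.Base using (ℕ; zero; suc; _+_; _≥_; s≤s; z≤n)
import Data.Nat.Base as ℕ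
import Data.Nat.Properties as ℕ
open import Data.Fin.Base
  using (Fin; zero; suc; toℕ; _<_; _↑ˡ_; _↑ʳ_; splitAt; punchIn; punchOut)
open import Data.Fin.Patterns using (0F; 1F; 2F; 3F; 4F; 5F)
open import Data.Fin.Properties
  using (_≟_; <-cmp; <⇒≢; toℕ-injective; toℕ-fromℕ<; punchInᵢ≢i; punchIn-punchOut;
         punchIn-injective; punchOut-injective; pigeonhole; injective⇒≤; +↔⊎;
         suc-injective; splitAt-↑ˡ; splitAt-↑ʳ)
open import Data.Fin.Permutation
  using (Permutation′; _⟨$⟩ʳ_; _⟨$⟩ˡ_; inverseˡ; inverseʳ; insert; insert-punchIn;
         transpose; flip)
import Data.Fin.Permutation as Perm
open import Data.Product.Base using (∃; ∃₂; _×_; _,_; proj₁; proj₂)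
open import Data.Sum.Base using (_⊎_; inj₁; inj₂; [_,_])
open import Data.Sum.Function.Propositional using (_⊎-↔_)
open import Data.Vec.Base using (Vec; []; _∷_; _++_; lookup; tabulate; map; _[_]≔_)
import Data.Vec.Base as Vec
open import Data.Vec.Properties
  using (lookup∘tabulate; tabulate∘lookup; tabulate-cong; lookup∘update;
         lookup∘update′; []≔-lookup; []≔-++-↑ˡ; lookup-++ˡ; lookup-++ʳ; lookup-splitAt)
open import Data.Vec.Relation.Unary.Any using (Any; here; there; any?)
import Data.Vec.Relation.Unary.Any as Any
open import Data.Vec.Relation.Unary.All using (All; []; _∷_)
open import Data.Vec.Relation.Unary.AllPairs using (allPairs?; []; _∷_)
open import Data.Vec.Relation.Unary.Unique.Propositional using (Unique)
open import Data.Vec.Relation.Unary.Unique.Propositional.Properties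
  using (lookup-injective)
open import Function.Base using (_∘_)
open import Function.Bundles using (_↔_; Inverse; Injection)
open import Function.Properties.Inverse using (↔⇒↣)
open import Function.Construct.Composition using (_↔-∘_)
open import Function.Construct.Symmetry using (↔-sym)
open import Function.Construct.Identity using (↔-id)
open import Function.Definitions using (Injective)
open import Relation.Binary.Definitions using (tri<; tri≈; tri>)
open import Relation.Binary.PropositionalEquality
  using (_≡_; _≢_; refl; sym; trans; cong; subst; module ≡-Reasoning)
open import Relation.Nullary.Decidable using (Dec; yes; no; ¬?; True; toWitness)
open import Relation.Nullary.Negation using (¬_; contradiction)
open import Defs

open ≡-Reasoning

private
  variable
    α β : Level
    A : Set α
    B : Set β
    m n r : ℕ

-- Reindexing and updating tuples

lookup-extensional : {u v : Vec A n} → (∀ i → lookup u i ≡ lookup v i) → u ≡ v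
lookup-extensional {u = u} {v} u≗v = begin
  u                    ≡⟨ tabulate∘lookup u ⟨
  tabulate (lookup u)  ≡⟨ tabulate-cong u≗v ⟩
  tabulate (lookup v)  ≡⟨ tabulate∘lookup v ⟩
  v                    ∎

lookup-⊙ : (v : Vec A n) (σ : Fin m → Fin n) (i : Fin m) →
           lookup (v ⊙ σ) i ≡ lookup v (σ i)
lookup-⊙ v σ = lookup∘tabulate (lookup v ∘ σ)

⊙-flip : (v : Vec A n) (σ : Permutation′ n) →
         (v ⊙ (flip σ ⟨$⟩ʳ_)) ⊙ (σ ⟨$⟩ʳ_) ≡ v
⊙-flip v σ = lookup-extensional λ i → begin
  lookup ((v ⊙ (flip σ ⟨$⟩ʳ_)) ⊙ (σ ⟨$⟩ʳ_)) i  ≡⟨ lookup-⊙ (v ⊙ (flip σ ⟨$⟩ʳ_)) (σ ⟨$⟩ʳ_) i ⟩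
  lookup (v ⊙ (flip σ ⟨$⟩ʳ_)) (σ ⟨$⟩ʳ i)       ≡⟨ lookup-⊙ v (flip σ ⟨$⟩ʳ_) (σ ⟨$⟩ʳ i) ⟩
  lookup v (σ ⟨$⟩ˡ (σ ⟨$⟩ʳ i))                 ≡⟨ cong (lookup v) (inverseˡ σ) ⟩
  lookup v i                                   ∎

⊙-update : (v : Vec A n) (σ : Permutation′ n) (i : Fin n) (x : A) →
           (v ⊙ (σ ⟨$⟩ʳ_)) [ i ]≔ x ≡ (v [ σ ⟨$⟩ʳ i ]≔ x) ⊙ (σ ⟨$⟩ʳ_)
⊙-update v σ i x = lookup-extensional λ k →
  trans (pointwise k) (sym (lookup-⊙ (v [ σ ⟨$⟩ʳ i ]≔ x) (σ ⟨$⟩ʳ_) k))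
  where
  pointwise : ∀ k → lookup ((v ⊙ (σ ⟨$⟩ʳ_)) [ i ]≔ x) k ≡
                    lookup (v [ σ ⟨$⟩ʳ i ]≔ x) (σ ⟨$⟩ʳ k)
  pointwise k with k ≟ i
  ... | yes refl = trans (lookup∘update k (v ⊙ (σ ⟨$⟩ʳ_)) x)
                         (sym (lookup∘update (σ ⟨$⟩ʳ k) v x))
  ... | no  k≢i  = begin
    lookup ((v ⊙ (σ ⟨$⟩ʳ_)) [ i ]≔ x) k      ≡⟨ lookup∘update′ k≢i (v ⊙ (σ ⟨$⟩ʳ_)) x ⟩
    lookup (v ⊙ (σ ⟨$⟩ʳ_)) k                 ≡⟨ lookup-⊙ v (σ ⟨$⟩ʳ_) k ⟩
    lookup v (σ ⟨$⟩ʳ k)                      ≡⟨ lookup∘update′ (k≢i ∘ Injection.injective (↔⇒↣ σ)) v x ⟨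
    lookup (v [ σ ⟨$⟩ʳ i ]≔ x) (σ ⟨$⟩ʳ k)    ∎

insert-image : (i j : Fin (suc n)) (π : Permutation′ n) → insert i j π ⟨$⟩ʳ i ≡ j
insert-image i j π with i ≟ i
... | yes _   = refl
... | no  i≢i = contradiction refl i≢i

-- Distinct positions

-- Drives the case distinctions below: a position handed over by a hypothesis is either already on
-- the list or lengthens it.
locate : (q : Fin n) {ps : Vec (Fin n) m} → Unique ps → Any (q ≡_) ps ⊎ Unique (q ∷ ps)
locate q {ps} u with any? (q ≟_) ps
... | yes q∈ps = inj₁ q∈ps
... | no  q∉ps = inj₂ (avoids ps q∉ps ∷ u)
  where
  avoids : ∀ {m} (ps : Vec _ m) → (Any (q ≡_) ps → _) → All (q ≢_) ps
  avoids []       _    = []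
  avoids (p ∷ ps) q∉ps = q∉ps ∘ here ∷ avoids ps (q∉ps ∘ there)

-- At each use `is` is a concrete list of indices, so its distinctness is decided by evaluation and
-- the implicit argument solves itself.
rearrange : {ps : Vec (Fin n) m} → Unique ps → (is : Vec (Fin m) r) →
            {True (allPairs? (λ i j → ¬? (i ≟ j)) is)} → Unique (map (lookup ps) is)
rearrange {ps = ps} u is {distinct} = go is (toWitness distinct)
  where
  go : ∀ {r} (is : Vec _ r) → Unique is → Unique (map (lookup ps) is)
  go []       _          = []
  go (i ∷ is) (i∉is ∷ v) = apart is i∉is ∷ go is v
    where
    apart : ∀ {r} (is : Vec _ r) → All (i ≢_) is → All (lookup ps i ≢_) (map (lookup ps) is)
    apart []       _              = []
    apart (j ∷ js) (i≢j ∷ i∉js)   = i≢j ∘ lookup-injective u i j ∷ apart js i∉js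

-- Induction on m: `insert` carries `φ zero` to the front, and the other positions, renumbered by
-- punching out `φ zero`, are straightened recursively.
straighten : (φ : Fin m → Fin (m + r)) → Injective _≡_ _≡_ φ →
             ∃ λ (σ : Permutation′ (m + r)) → ∀ i → σ ⟨$⟩ʳ φ i ≡ i ↑ˡ r
straighten {zero}      φ φ-inj = Perm.id , λ ()
straighten {suc m} {r} φ φ-inj = insert (φ zero) zero σ , image
  where
  φ₀≢ : ∀ i → φ zero ≢ φ (suc i)
  φ₀≢ i eq with () ← φ-inj eq

  tail : ∃ λ (σ : Permutation′ (m + r)) → ∀ i → σ ⟨$⟩ʳ punchOut (φ₀≢ i) ≡ i ↑ˡ r
  tail = straighten (punchOut ∘ φ₀≢) λ {i} {j} eq →
    suc-injective (φ-inj (punchOut-injective (φ₀≢ i) (φ₀≢ j) eq))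

  σ : Permutation′ (m + r)
  σ = proj₁ tail

  image : ∀ i → insert (φ zero) zero σ ⟨$⟩ʳ φ i ≡ i ↑ˡ r
  image zero    = insert-image (φ zero) zero σ
  image (suc i) = begin
    insert (φ zero) zero σ ⟨$⟩ʳ φ (suc i)
      ≡⟨ cong (insert (φ zero) zero σ ⟨$⟩ʳ_) (punchIn-punchOut (φ₀≢ i)) ⟨
    insert (φ zero) zero σ ⟨$⟩ʳ punchIn (φ zero) (punchOut (φ₀≢ i))
      ≡⟨ insert-punchIn (φ zero) zero σ (punchOut (φ₀≢ i)) ⟩
    suc (σ ⟨$⟩ʳ punchOut (φ₀≢ i))
      ≡⟨ cong suc (proj₂ tail i) ⟩
    suc (i ↑ˡ r) ∎

straighten-unique : {ps : Vec (Fin (m + r)) m} → Unique ps →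
  ∃ λ (σ : Permutation′ (m + r)) → ∀ i → σ ⟨$⟩ʳ lookup ps i ≡ i ↑ˡ r
straighten-unique {ps = ps} u = straighten (lookup ps) (lookup-injective u _ _)

-- A straightening permutation moves `ps` onto the first m positions, so whatever it moves to
-- position m lies outside `ps`.
fresh : {ps : Vec (Fin (m + suc r)) m} → Unique ps → ∃ λ q → Unique (q ∷ ps)
fresh {m} {r} {ps} u with σ , σ-ps ← straighten-unique {m} {suc r} u
  with locate (σ ⟨$⟩ˡ (m ↑ʳ zero)) u
... | inj₂ v    = _ , v
... | inj₁ q∈ps = contradiction (begin
    inj₁ k                                  ≡⟨ splitAt-↑ˡ m k (suc r) ⟨
    splitAt m (k ↑ˡ suc r)                  ≡⟨ cong (splitAt m) (σ-ps k) ⟨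
    splitAt m (σ ⟨$⟩ʳ lookup ps k)          ≡⟨ cong (λ p → splitAt m (σ ⟨$⟩ʳ p)) (found q∈ps) ⟨
    splitAt m (σ ⟨$⟩ʳ (σ ⟨$⟩ˡ (m ↑ʳ zero)))  ≡⟨ cong (splitAt m) (inverseʳ σ) ⟩
    splitAt m (m ↑ʳ zero)                   ≡⟨ splitAt-↑ʳ m (suc r) zero ⟩
    inj₂ zero                               ∎) λ ()
  where
  k = Any.index q∈ps
  found : ∀ {q m} {ps : Vec (Fin n) m} (e : Any (q ≡_) ps) → q ≡ lookup ps (Any.index e)
  found (here eq) = eq
  found (there e) = found e

-- Arguments at the front of a totally symmetric function

-- Up to reordering, b is the tuple xs ++ M, with xs sitting at the positions ps.
record Holds {A : Set α} {B : Set β} (f : Vec A (m + r) → B) (ps : Vec (Fin (m + r)) m)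
             (b : Vec A (m + r)) (xs : Vec A m) (M : Vec A r) : Set (α ⊔ β) where
  constructor holds
  field
    reads  : ∀ i → lookup b (lookup ps i) ≡ lookup xs i
    writes : ∀ i x → f (b [ lookup ps i ]≔ x) ≡ f ((xs [ i ]≔ x) ++ M)

  copies : ∀ i q → f (b [ lookup ps i ]≔ lookup b (lookup ps q)) ≡ f ((xs [ i ]≔ lookup xs q) ++ M)
  copies i q = trans (writes i _) (cong (λ x → f ((xs [ i ]≔ x) ++ M)) (reads q))

  -- Overwriting an entry with itself changes nothing; hence the need for some index i.
  agrees : (i : Fin m) → f b ≡ f (xs ++ M)
  agrees i = begin
    f b                                            ≡⟨ cong f ([]≔-lookup b (lookup ps i)) ⟨
    f (b [ lookup ps i ]≔ lookup b (lookup ps i))  ≡⟨ copies i i ⟩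
    f ((xs [ i ]≔ lookup xs i) ++ M)               ≡⟨ cong (λ v → f (v ++ M)) ([]≔-lookup xs i) ⟩
    f (xs ++ M)                                    ∎

  transfers : ∀ i j → lookup b (lookup ps i) ≡ lookup b (lookup ps j) → lookup xs i ≡ lookup xs j
  transfers i j eq = trans (sym (reads i)) (trans eq (reads j))

  reflects : ∀ i j → lookup xs i ≡ lookup xs j → lookup b (lookup ps i) ≡ lookup b (lookup ps j)
  reflects i j eq = trans (reads i) (trans eq (sym (reads j)))

open Holds

-- An update passes through the reordering by `⊙-update`, and total symmetry then removes the
-- reordering.
holds-⊙ : {f : Vec A (m + r) → B} → TotallySymmetric f → {ps : Vec (Fin (m + r)) m} →
          (σ : Permutation′ (m + r)) → (∀ i → σ ⟨$⟩ʳ lookup ps i ≡ i ↑ˡ r) →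
          (xs : Vec A m) (M : Vec A r) → Holds f ps ((xs ++ M) ⊙ (σ ⟨$⟩ʳ_)) xs M
holds-⊙ {m = m} {r = r} {f = f} f-sym {ps} σ σ-ps xs M = holds
  (λ i → begin
    lookup ((xs ++ M) ⊙ (σ ⟨$⟩ʳ_)) (lookup ps i)  ≡⟨ lookup-⊙ (xs ++ M) (σ ⟨$⟩ʳ_) (lookup ps i) ⟩
    lookup (xs ++ M) (σ ⟨$⟩ʳ lookup ps i)         ≡⟨ cong (lookup (xs ++ M)) (σ-ps i) ⟩
    lookup (xs ++ M) (i ↑ˡ r)                     ≡⟨ lookup-++ˡ xs M i ⟩
    lookup xs i                                   ∎)
  (λ i x → begin
    f (((xs ++ M) ⊙ (σ ⟨$⟩ʳ_)) [ lookup ps i ]≔ x)     ≡⟨ cong f (⊙-update (xs ++ M) σ (lookup ps i) x) ⟩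
    f (((xs ++ M) [ σ ⟨$⟩ʳ lookup ps i ]≔ x) ⊙ (σ ⟨$⟩ʳ_))  ≡⟨ f-sym _ σ ⟨
    f ((xs ++ M) [ σ ⟨$⟩ʳ lookup ps i ]≔ x)            ≡⟨ cong (λ p → f ((xs ++ M) [ p ]≔ x)) (σ-ps i) ⟩
    f ((xs ++ M) [ i ↑ˡ r ]≔ x)                        ≡⟨ cong f ([]≔-++-↑ˡ xs M i) ⟩
    f ((xs [ i ]≔ x) ++ M)                             ∎)

place : {f : Vec A (m + r) → B} → TotallySymmetric f → {ps : Vec (Fin (m + r)) m} →
        Unique ps → (xs : Vec A m) (M : Vec A r) → ∃ λ b → Holds f ps b xs M
place {m = m} f-sym u xs M with σ , σ-ps ← straighten-unique {m} u =
  _ , holds-⊙ f-sym σ σ-ps xs M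

-- Undoing the straightening permutation brings the entries at `ps` to the front, where they are
-- split off; redoing it returns b.
extract : {f : Vec A (m + r) → B} → TotallySymmetric f → {ps : Vec (Fin (m + r)) m} →
          Unique ps → (b : Vec A (m + r)) → ∃₂ λ xs M → Holds f ps b xs M
extract {m = m} {f = f} f-sym {ps} u b with σ , σ-ps ← straighten-unique {m} u
  with Vec.splitAt m (b ⊙ (flip σ ⟨$⟩ʳ_))
... | xs , M , eq = xs , M ,
  subst (λ v → Holds f ps v xs M)
        (trans (cong (_⊙ (σ ⟨$⟩ʳ_)) (sym eq)) (⊙-flip b σ))
        (holds-⊙ f-sym σ σ-ps xs M)

-- Extend τ by the identity on the last r positions, through the splitting of the positions into two
-- blocks.
symmetric-front : {f : Vec A (m + r) → B} → TotallySymmetric f → (τ : Permutation′ m) →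
                  (xs : Vec A m) (M : Vec A r) → f (xs ++ M) ≡ f ((xs ⊙ (τ ⟨$⟩ʳ_)) ++ M)
symmetric-front {m = m} {r = r} {f = f} f-sym τ xs M =
  trans (f-sym (xs ++ M) σ) (cong f (lookup-extensional λ i → begin
    lookup ((xs ++ M) ⊙ (σ ⟨$⟩ʳ_)) i                    ≡⟨ lookup-⊙ (xs ++ M) (σ ⟨$⟩ʳ_) i ⟩
    lookup (xs ++ M) (σ ⟨$⟩ʳ i)                         ≡⟨ moved (splitAt m i) ⟩
    [ lookup (xs ⊙ (τ ⟨$⟩ʳ_)) , lookup M ] (splitAt m i) ≡⟨ lookup-splitAt m (xs ⊙ (τ ⟨$⟩ʳ_)) M i ⟨
    lookup ((xs ⊙ (τ ⟨$⟩ʳ_)) ++ M) i                    ∎))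
  where
  block : (Fin m ⊎ Fin r) ↔ (Fin m ⊎ Fin r)
  block = τ ⊎-↔ ↔-id (Fin r)

  σ : Permutation′ (m + r)
  σ = ↔-sym +↔⊎ ↔-∘ (block ↔-∘ +↔⊎)

  moved : ∀ s → lookup (xs ++ M) (Inverse.from (+↔⊎ {m} {r}) (Inverse.to block s)) ≡
                [ lookup (xs ⊙ (τ ⟨$⟩ʳ_)) , lookup M ] s
  moved (inj₁ i) = trans (lookup-++ˡ xs M (τ ⟨$⟩ʳ i)) (sym (lookup-⊙ xs (τ ⟨$⟩ʳ_) i))
  moved (inj₂ j) = lookup-++ʳ xs M j

swap-front : {f : Vec A (m + r) → B} → TotallySymmetric f → (i j : Fin m) →
             (xs : Vec A m) (M : Vec A r) →
             f (xs ++ M) ≡ f ((xs ⊙ (transpose i j ⟨$⟩ʳ_)) ++ M)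
swap-front {f = f} f-sym i j = symmetric-front {f = f} f-sym (transpose i j)

-- The digits in the names are the multiplicities of x, y (and z) on either side.

31≡22 : {A : Set α} {B : Set β} → (Vec A (4 + r) → B) → Set (α ⊔ β)
31≡22 f = ∀ x y M → f (x ∷ x ∷ x ∷ y ∷ M) ≡ f (x ∷ x ∷ y ∷ y ∷ M)

221≡212 : {A : Set α} {B : Set β} → (Vec A (5 + r) → B) → Set (α ⊔ β)
221≡212 f = ∀ x y z M → f (x ∷ x ∷ y ∷ y ∷ z ∷ M) ≡ f (x ∷ x ∷ z ∷ y ∷ z ∷ M)

131≡212 : {A : Set α} {B : Set β} → (Vec A (5 + r) → B) → Set (α ⊔ β)
131≡212 f = ∀ x y z M → f (y ∷ x ∷ y ∷ y ∷ z ∷ M) ≡ f (x ∷ x ∷ z ∷ y ∷ z ∷ M)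

-- The two hypotheses share their right-hand side, so their left-hand sides agree; the first entry
-- of the remaining tuple serves as z.
221≡212∧131≡212⇒31≡22 : {f : Vec A (5 + r) → B} → TotallySymmetric f →
                        221≡212 f → 131≡212 f → 31≡22 f
221≡212∧131≡212⇒31≡22 {f = f} f-sym h₁ h₂ x y (z ∷ M) = begin
  f (x ∷ x ∷ x ∷ y ∷ z ∷ M)  ≡⟨ swap 1F 3F (x ∷ x ∷ x ∷ y ∷ z ∷ []) ⟩
  f (x ∷ y ∷ x ∷ x ∷ z ∷ M)  ≡⟨ h₂ y x z M ⟩
  f (y ∷ y ∷ z ∷ x ∷ z ∷ M)  ≡⟨ h₁ y x z M ⟨
  f (y ∷ y ∷ x ∷ x ∷ z ∷ M)  ≡⟨ swap 0F 2F (y ∷ y ∷ x ∷ x ∷ z ∷ []) ⟩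
  f (x ∷ y ∷ y ∷ x ∷ z ∷ M)  ≡⟨ swap 1F 3F (x ∷ y ∷ y ∷ x ∷ z ∷ []) ⟩
  f (x ∷ x ∷ y ∷ y ∷ z ∷ M)  ∎
  where
  swap : ∀ i j (xs : Vec _ 5) → f (xs ++ M) ≡ f ((xs ⊙ (transpose i j ⟨$⟩ʳ_)) ++ M)
  swap i j xs = swap-front {f = f} f-sym i j xs M

-- Relations between f and g

Replaces : {A : Set α} {B : Set β} (f g : Vec A n → B) → Fin n → Fin n → Fin n → Set (α ⊔ β)
Replaces f g i j q = ∀ b → lookup b i ≡ lookup b j → g b ≡ f (b [ i ]≔ lookup b q)

-- What survives of `Replaces f g i j q` when q is one of i, j, k. Being symmetric in these three
-- positions, it carries information from one pair inside the triple to another.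
Fixes : {A : Set α} {B : Set β} (f g : Vec A n → B) → Fin n → Fin n → Fin n → Set (α ⊔ β)
Fixes f g i j k = ∀ b → lookup b i ≡ lookup b j → lookup b i ≡ lookup b k → g b ≡ f b

evaluate : {f g : Vec A (m + r) → B} {ps : Vec (Fin (m + r)) m} {b : Vec A (m + r)}
           {xs : Vec A m} {M : Vec A r} → Holds f ps b xs M → (i j q : Fin m) →
           Replaces f g (lookup ps i) (lookup ps j) (lookup ps q) →
           lookup xs i ≡ lookup xs j → g b ≡ f ((xs [ i ]≔ lookup xs q) ++ M)
evaluate h i j q ijq xᵢ≡xⱼ = trans (ijq _ (reflects h i j xᵢ≡xⱼ)) (copies h i q)

module _ {f g : Vec A n → B} where

  Replaces⇒Fixes : ∀ {i j k q} → Any (q ≡_) (i ∷ j ∷ k ∷ []) → Replaces f g i j q → Fixes f g i j k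
  Replaces⇒Fixes {i} {j} {k} {q} q∈ ijq b bᵢ≡bⱼ bᵢ≡bₖ = begin
    g b                      ≡⟨ ijq b bᵢ≡bⱼ ⟩
    f (b [ i ]≔ lookup b q)  ≡⟨ cong (λ x → f (b [ i ]≔ x)) (constant q∈) ⟩
    f (b [ i ]≔ lookup b i)  ≡⟨ cong f ([]≔-lookup b i) ⟩
    f b                      ∎
    where
    constant : Any (q ≡_) (i ∷ j ∷ k ∷ []) → lookup b q ≡ lookup b i
    constant (here refl)                 = refl
    constant (there (here refl))         = sym bᵢ≡bⱼ
    constant (there (there (here refl))) = sym bᵢ≡bₖ

  Fixes-132 : ∀ {i j k} → Fixes f g i j k → Fixes f g i k j
  Fixes-132 h b p q = h b q p

  Fixes-231 : ∀ {i j k} → Fixes f g i j k → Fixes f g j k i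
  Fixes-231 h b p q = h b (sym q) (trans (sym q) p)

  Fixes-312 : ∀ {i j k} → Fixes f g i j k → Fixes f g k i j
  Fixes-312 h = Fixes-231 (Fixes-231 h)

  Replaces-end : ∀ {i j} → Replaces f g i j j → Replaces f g i j i
  Replaces-end {i} h b bᵢ≡bⱼ = trans (h b bᵢ≡bⱼ) (cong (λ x → f (b [ i ]≔ x)) (sym bᵢ≡bⱼ))

-- Overwriting one or the other of two equal entries leaves the same multiset.
Replaces-sym : {f g : Vec A (2 + r) → B} → TotallySymmetric f → ∀ {i j q} → i ≢ j →
               Replaces f g i j q → Replaces f g j i q
Replaces-sym {f = f} {g} f-sym {i} {j} {q} i≢j ijq b bⱼ≡bᵢ =
  let xs , M , h = extract f-sym ((i≢j ∷ []) ∷ [] ∷ []) b in go xs M h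
  where
  go : ∀ xs M → Holds f (i ∷ j ∷ []) b xs M → g b ≡ f (b [ j ]≔ lookup b q)
  go (x ∷ y ∷ []) M h = begin
    g b                      ≡⟨ ijq b (sym bⱼ≡bᵢ) ⟩
    f (b [ i ]≔ lookup b q)  ≡⟨ writes h 0F _ ⟩
    f (lookup b q ∷ y ∷ M)   ≡⟨ cong (λ z → f (lookup b q ∷ z ∷ M)) y≡x ⟩
    f (lookup b q ∷ x ∷ M)   ≡⟨ swap-front {f = f} f-sym 0F 1F (lookup b q ∷ x ∷ []) M ⟩
    f (x ∷ lookup b q ∷ M)   ≡⟨ writes h 1F _ ⟨
    f (b [ j ]≔ lookup b q)  ∎
    where
    y≡x : y ≡ x
    y≡x = transfers h 1F 0F bⱼ≡bᵢ

module _ {f g : Vec A (4 + r) → B} (f-sym : TotallySymmetric f) where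

  -- Take x at i, j, k and y at l: there g is f of the tuple itself, and also f of the tuple with
  -- one x turned into y.
  Fixes∧Replaces⇒31≡22 : ∀ {i j k l} → Unique (l ∷ i ∷ j ∷ k ∷ []) →
                         Fixes f g i j k → Replaces f g i j l → 31≡22 f
  Fixes∧Replaces⇒31≡22 u ijk ijl x y M =
    let b , h = place f-sym (rearrange u (1F ∷ 2F ∷ 3F ∷ 0F ∷ [])) (x ∷ x ∷ x ∷ y ∷ []) M in begin
    f (x ∷ x ∷ x ∷ y ∷ M)  ≡⟨ agrees h 0F ⟨
    f b                    ≡⟨ ijk b (reflects h 0F 1F refl) (reflects h 0F 2F refl) ⟨
    g b                    ≡⟨ evaluate h 0F 1F 3F ijl refl ⟩
    f (y ∷ x ∷ x ∷ y ∷ M)  ≡⟨ swap-front {f = f} f-sym 0F 2F (y ∷ x ∷ x ∷ y ∷ []) M ⟩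
    f (x ∷ x ∷ y ∷ y ∷ M)  ∎

  -- With x at i, j and y at k, l, the first rule leaves the tuple alone, while the second turns the
  -- y at k into the x found at j.
  disjoint⇒31≡22 : ∀ {i j k l} → Unique (i ∷ j ∷ k ∷ l ∷ []) →
                   Replaces f g i j i → Replaces f g k l j → 31≡22 f
  disjoint⇒31≡22 u iji klj x y M =
    let b , h = place f-sym u (x ∷ x ∷ y ∷ y ∷ []) M in begin
    f (x ∷ x ∷ x ∷ y ∷ M)  ≡⟨ evaluate h 2F 3F 1F klj refl ⟨
    g b                    ≡⟨ evaluate h 0F 1F 0F iji refl ⟩
    f (x ∷ x ∷ y ∷ y ∷ M)  ∎

module _ {f g : Vec A (5 + r) → B} (f-sym : TotallySymmetric f) where

  -- As for `disjoint⇒31≡22`, but the second rule now copies a value z from a fifth position.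
  disjoint⇒221≡212 : ∀ {i j k l q} → Unique (i ∷ j ∷ k ∷ l ∷ q ∷ []) →
                     Replaces f g i j i → Replaces f g k l q → 221≡212 f
  disjoint⇒221≡212 u iji klq x y z M =
    let b , h = place f-sym u (x ∷ x ∷ y ∷ y ∷ z ∷ []) M in begin
    f (x ∷ x ∷ y ∷ y ∷ z ∷ M)  ≡⟨ evaluate h 0F 1F 0F iji refl ⟨
    g b                        ≡⟨ evaluate h 2F 3F 4F klq refl ⟩
    f (x ∷ x ∷ z ∷ y ∷ z ∷ M)  ∎

  -- The pairs share i, so x is put at i, j and k; the two rules overwrite entry i with the y at q
  -- and with the z at s. Position i is listed third because that is where the two sides differ.
  overlapping⇒221≡212 : ∀ {i j k q s} → Unique (i ∷ j ∷ k ∷ q ∷ s ∷ []) →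
                        Replaces f g i j q → Replaces f g i k s → 221≡212 f
  overlapping⇒221≡212 u ijq iks x y z M =
    let b , h = place f-sym (rearrange u (1F ∷ 2F ∷ 0F ∷ 3F ∷ 4F ∷ [])) (x ∷ x ∷ x ∷ y ∷ z ∷ []) M in begin
    f (x ∷ x ∷ y ∷ y ∷ z ∷ M)  ≡⟨ evaluate h 2F 0F 3F ijq refl ⟨
    g b                        ≡⟨ evaluate h 2F 1F 4F iks refl ⟩
    f (x ∷ x ∷ z ∷ y ∷ z ∷ M)  ∎

  -- The position k read by the first rule belongs to the second pair: the first rule turns an x
  -- into y, the second turns a y into z.
  linked⇒131≡212 : ∀ {i j k l q} → Unique (i ∷ j ∷ k ∷ l ∷ q ∷ []) →
                   Replaces f g i j k → Replaces f g k l q → 131≡212 f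
  linked⇒131≡212 u ijk klq x y z M =
    let b , h = place f-sym u (x ∷ x ∷ y ∷ y ∷ z ∷ []) M in begin
    f (y ∷ x ∷ y ∷ y ∷ z ∷ M)  ≡⟨ evaluate h 0F 1F 2F ijk refl ⟨
    g b                        ≡⟨ evaluate h 2F 3F 4F klq refl ⟩
    f (x ∷ x ∷ z ∷ y ∷ z ∷ M)  ∎

apart : {ps : Vec (Fin n) m} → Unique ps → (i j : Fin m) → {True (¬? (i ≟ j))} →
        lookup ps i ≢ lookup ps j
apart u i j {i≢j} = toWitness i≢j ∘ lookup-injective u i j

¬unique-five : {ps : Vec (Fin 4) 5} → ¬ Unique ps
¬unique-five u = ℕ.n≮n 4 (injective⇒≤ (lookup-injective u _ _))

-- Phrased over `4 + r` to fit the case analysis: for `r = zero` there are no five distinct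
-- positions, and otherwise a fifth argument is available to play z.
disjoint∧linked⇒31≡22 : {f g : Vec A (4 + r) → B} → TotallySymmetric f →
  ∀ {i j k l q} → Unique (i ∷ j ∷ k ∷ l ∷ q ∷ []) → Replaces f g i j i → Replaces f g k l q →
  ∀ {i j k l q} → Unique (i ∷ j ∷ k ∷ l ∷ q ∷ []) → Replaces f g i j k → Replaces f g k l q →
  31≡22 f
disjoint∧linked⇒31≡22 {r = zero}  f-sym u _ _ _ _ _ = contradiction u ¬unique-five
disjoint∧linked⇒31≡22 {r = suc r} f-sym u iji klq v ijk klq′ =
  221≡212∧131≡212⇒31≡22 f-sym (disjoint⇒221≡212 f-sym u iji klq) (linked⇒131≡212 f-sym v ijk klq′)

overlapping∧linked⇒31≡22 : {f g : Vec A (4 + r) → B} → TotallySymmetric f →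
  ∀ {i j k q s} → Unique (i ∷ j ∷ k ∷ q ∷ s ∷ []) → Replaces f g i j q → Replaces f g i k s →
  ∀ {i j k l q} → Unique (i ∷ j ∷ k ∷ l ∷ q ∷ []) → Replaces f g i j k → Replaces f g k l q →
  31≡22 f
overlapping∧linked⇒31≡22 {r = zero}  f-sym u _ _ _ _ _ = contradiction u ¬unique-five
overlapping∧linked⇒31≡22 {r = suc r} f-sym u ijq iks v ijk klq =
  221≡212∧131≡212⇒31≡22 f-sym (overlapping⇒221≡212 f-sym u ijq iks) (linked⇒131≡212 f-sym v ijk klq)

-- The case analysis on the replacing positions

Replaceable : {A : Set α} {B : Set β} (f g : Vec A n → B) → Set (α ⊔ β)
Replaceable f g = ∀ {i j} → i ≢ j → ∃ λ q → Replaces f g i j q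

-- The rule is consulted for c d, then, if that yields a new position w, for d w, and, if this pair
-- reads from itself, for a d. Most answers produce a `Fixes` triple together with a rule on one of
-- its pairs that reads from outside, which is `clash`.
mixed⇒31≡22 : {f g : Vec A (4 + r) → B} → TotallySymmetric f → Replaceable f g →
              ∀ {a b c d} → Unique (d ∷ a ∷ b ∷ c ∷ []) →
              Replaces f g a b a → Replaces f g a c b → 31≡22 f
mixed⇒31≡22 {f = f} {g} f-sym rule {a} {b} {c} {d} u aba acb =
  let q , cdq = rule (apart u 3F 0F) in split-cd cdq (locate q u)
  where
  clash : ∀ {i j k l} → Unique (l ∷ i ∷ j ∷ k ∷ []) → Fixes f g i j k → Replaces f g i j l → 31≡22 f
  clash = Fixes∧Replaces⇒31≡22 f-sym

  fixed-acd : Fixes f g a c d → 31≡22 f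
  fixed-acd acd = clash (rearrange u (2F ∷ 1F ∷ 3F ∷ 0F ∷ [])) acd acb

  split-ad : ∀ {w t} → Unique (w ∷ d ∷ a ∷ b ∷ c ∷ []) → Fixes f g a d w → Replaces f g a d t →
             Any (t ≡_) (w ∷ d ∷ a ∷ b ∷ c ∷ []) ⊎ Unique (t ∷ w ∷ d ∷ a ∷ b ∷ c ∷ []) → 31≡22 f
  split-ad v adw adt (inj₁ (here refl)) =
    clash (rearrange v (0F ∷ 2F ∷ 1F ∷ 3F ∷ []))
          (Fixes-132 (Replaces⇒Fixes (here refl) aba)) adt
  split-ad v adw adt (inj₁ (there (here refl))) =
    fixed-acd (Fixes-132 (Replaces⇒Fixes (there (here refl)) adt))
  split-ad v adw adt (inj₁ (there (there (here refl)))) =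
    fixed-acd (Fixes-132 (Replaces⇒Fixes (here refl) adt))
  split-ad v adw adt (inj₁ (there (there (there (here refl))))) =
    clash (rearrange v (3F ∷ 2F ∷ 1F ∷ 0F ∷ [])) adw adt
  split-ad v adw adt (inj₁ (there (there (there (there (here refl)))))) =
    clash (rearrange v (4F ∷ 2F ∷ 1F ∷ 0F ∷ [])) adw adt
  split-ad v adw adt (inj₂ v′) =
    clash (rearrange v′ (0F ∷ 3F ∷ 2F ∷ 1F ∷ [])) adw adt

  fixed-adw : ∀ {w} → Unique (w ∷ d ∷ a ∷ b ∷ c ∷ []) → Fixes f g a d w → 31≡22 f
  fixed-adw v adw = let t , adt = rule (apart v 2F 1F) in split-ad v adw adt (locate t v)

  split-dw : ∀ {w s} → Unique (w ∷ d ∷ a ∷ b ∷ c ∷ []) → Replaces f g c d w → Replaces f g d w s →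
             Any (s ≡_) (w ∷ d ∷ a ∷ b ∷ c ∷ []) ⊎ Unique (s ∷ w ∷ d ∷ a ∷ b ∷ c ∷ []) → 31≡22 f
  split-dw v cdw dws (inj₁ (here refl)) =
    fixed-adw v (Fixes-312 (Replaces⇒Fixes (there (here refl)) dws))
  split-dw v cdw dws (inj₁ (there (here refl))) =
    fixed-adw v (Fixes-312 (Replaces⇒Fixes (here refl) dws))
  split-dw v cdw dws (inj₁ (there (there (here refl)))) =
    clash (rearrange v (2F ∷ 1F ∷ 0F ∷ 4F ∷ []))
          (Fixes-231 (Replaces⇒Fixes (there (there (here refl))) cdw)) dws
  split-dw v cdw dws (inj₁ (there (there (there (here refl))))) =
    clash (rearrange v (3F ∷ 1F ∷ 0F ∷ 4F ∷ []))
          (Fixes-231 (Replaces⇒Fixes (there (there (here refl))) cdw)) dws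
  -- Here `Fixes` gives no clash. Instead a b and c d are disjoint, and d w reads from c, which lies
  -- in the pair c a.
  split-dw v cdw dwc (inj₁ (there (there (there (there (here refl)))))) =
    disjoint∧linked⇒31≡22 f-sym
      (rearrange v (2F ∷ 3F ∷ 4F ∷ 1F ∷ 0F ∷ [])) aba cdw
      (rearrange v (1F ∷ 0F ∷ 4F ∷ 2F ∷ 3F ∷ [])) dwc (Replaces-sym f-sym (apart v 2F 4F) acb)
  split-dw v cdw dws (inj₂ v′) =
    clash (rearrange v′ (0F ∷ 2F ∷ 1F ∷ 5F ∷ []))
          (Fixes-231 (Replaces⇒Fixes (there (there (here refl))) cdw)) dws

  split-cd : ∀ {q} → Replaces f g c d q →
             Any (q ≡_) (d ∷ a ∷ b ∷ c ∷ []) ⊎ Unique (q ∷ d ∷ a ∷ b ∷ c ∷ []) → 31≡22 f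
  split-cd cdq (inj₁ (here refl)) = fixed-acd (Fixes-312 (Replaces⇒Fixes (there (here refl)) cdq))
  split-cd cdq (inj₁ (there (here refl))) =
    fixed-acd (Fixes-312 (Replaces⇒Fixes (there (there (here refl))) cdq))
  split-cd cdq (inj₁ (there (there (here refl)))) =
    -- The pair c d reads from b, a member of the disjoint pair a b.
    disjoint⇒31≡22 f-sym (rearrange u (1F ∷ 2F ∷ 3F ∷ 0F ∷ [])) aba cdq
  split-cd cdq (inj₁ (there (there (there (here refl))))) =
    fixed-acd (Fixes-312 (Replaces⇒Fixes (here refl) cdq))
  split-cd {w} cdw (inj₂ v) = let s , dws = rule (apart v 1F 0F) in split-dw v cdw dws (locate s v)

-- Each pair inside the triple reads from the third position. The rule is consulted for a d, then
-- for b d if a d reads from a new position w, and then for d w if b d reads from w as well; the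
-- remaining answers mostly end in a `clash`.
cyclic⇒31≡22 : {f g : Vec A (4 + r) → B} → TotallySymmetric f → Replaceable f g →
               ∀ {a b c d} → Unique (d ∷ a ∷ b ∷ c ∷ []) →
               Replaces f g a b c → Replaces f g a c b → Replaces f g b c a → 31≡22 f
cyclic⇒31≡22 {f = f} {g} f-sym rule {a} {b} {c} {d} u abc acb bca =
  let q , adq = rule (apart u 1F 0F) in split-ad adq (locate q u)
  where
  clash : ∀ {i j k l} → Unique (l ∷ i ∷ j ∷ k ∷ []) → Fixes f g i j k → Replaces f g i j l → 31≡22 f
  clash = Fixes∧Replaces⇒31≡22 f-sym

  fixed-abd : Fixes f g a b d → 31≡22 f
  fixed-abd abd = clash (rearrange u (3F ∷ 1F ∷ 2F ∷ 0F ∷ [])) abd abc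

  split-dw : ∀ {w t} → Unique (w ∷ d ∷ a ∷ b ∷ c ∷ []) → Replaces f g a d w → Replaces f g b d w →
             Replaces f g d w t →
             Any (t ≡_) (w ∷ d ∷ a ∷ b ∷ c ∷ []) ⊎ Unique (t ∷ w ∷ d ∷ a ∷ b ∷ c ∷ []) → 31≡22 f
  split-dw v adw bdw dwt (inj₁ (here refl)) =
    -- The pair d w reads from itself and is disjoint from b c, which reads from a; a in turn lies
    -- in the pair a d, which reads from w.
    disjoint∧linked⇒31≡22 f-sym
      (rearrange v (1F ∷ 0F ∷ 3F ∷ 4F ∷ 2F ∷ [])) (Replaces-end {f = f} {g} dwt) bca
      (rearrange v (3F ∷ 4F ∷ 2F ∷ 1F ∷ 0F ∷ [])) bca adw
  split-dw v adw bdw dwt (inj₁ (there (here refl))) =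
    disjoint∧linked⇒31≡22 f-sym
      (rearrange v (1F ∷ 0F ∷ 3F ∷ 4F ∷ 2F ∷ [])) dwt bca
      (rearrange v (3F ∷ 4F ∷ 2F ∷ 1F ∷ 0F ∷ [])) bca adw
  split-dw v adw bdw dwt (inj₁ (there (there (here refl)))) =
    clash (rearrange v (2F ∷ 1F ∷ 0F ∷ 3F ∷ []))
          (Fixes-231 (Replaces⇒Fixes (there (there (here refl))) bdw)) dwt
  split-dw v adw bdw dwt (inj₁ (there (there (there (here refl))))) =
    clash (rearrange v (3F ∷ 1F ∷ 0F ∷ 2F ∷ []))
          (Fixes-231 (Replaces⇒Fixes (there (there (here refl))) adw)) dwt
  split-dw v adw bdw dwt (inj₁ (there (there (there (there (here refl)))))) =
    clash (rearrange v (4F ∷ 1F ∷ 0F ∷ 2F ∷ []))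
          (Fixes-231 (Replaces⇒Fixes (there (there (here refl))) adw)) dwt
  split-dw v adw bdw dwt (inj₂ v′) =
    clash (rearrange v′ (0F ∷ 2F ∷ 1F ∷ 3F ∷ []))
          (Fixes-231 (Replaces⇒Fixes (there (there (here refl))) adw)) dwt

  split-bd : ∀ {w s} → Unique (w ∷ d ∷ a ∷ b ∷ c ∷ []) → Replaces f g a d w → Replaces f g b d s →
             Any (s ≡_) (w ∷ d ∷ a ∷ b ∷ c ∷ []) ⊎ Unique (s ∷ w ∷ d ∷ a ∷ b ∷ c ∷ []) → 31≡22 f
  split-bd v adw bds (inj₁ (here refl)) =
    let t , dwt = rule (apart v 1F 0F) in split-dw v adw bds dwt (locate t v)
  split-bd v adw bds (inj₁ (there (here refl))) =
    fixed-abd (Fixes-312 (Replaces⇒Fixes (there (here refl)) bds))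
  split-bd v adw bds (inj₁ (there (there (here refl)))) =
    fixed-abd (Fixes-312 (Replaces⇒Fixes (there (there (here refl))) bds))
  split-bd v adw bds (inj₁ (there (there (there (here refl))))) =
    fixed-abd (Fixes-312 (Replaces⇒Fixes (here refl) bds))
  split-bd v adw bds (inj₁ (there (there (there (there (here refl)))))) =
    clash (rearrange u (1F ∷ 2F ∷ 3F ∷ 0F ∷ []))
          (Fixes-132 (Replaces⇒Fixes (there (there (here refl))) bds)) bca
  split-bd v adw bds (inj₂ v′) =
    -- The pairs d a and d b overlap in d and read from two different new positions.
    overlapping∧linked⇒31≡22 f-sym
      (rearrange v′ (2F ∷ 3F ∷ 4F ∷ 1F ∷ 0F ∷ []))
      (Replaces-sym f-sym (apart v 2F 1F) adw) (Replaces-sym f-sym (apart v 3F 1F) bds)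
      (rearrange v (3F ∷ 4F ∷ 2F ∷ 1F ∷ 0F ∷ [])) bca adw

  split-ad : ∀ {q} → Replaces f g a d q →
             Any (q ≡_) (d ∷ a ∷ b ∷ c ∷ []) ⊎ Unique (q ∷ d ∷ a ∷ b ∷ c ∷ []) → 31≡22 f
  split-ad adq (inj₁ (here refl)) = fixed-abd (Fixes-132 (Replaces⇒Fixes (there (here refl)) adq))
  split-ad adq (inj₁ (there (here refl))) = fixed-abd (Fixes-132 (Replaces⇒Fixes (here refl) adq))
  split-ad adq (inj₁ (there (there (here refl)))) =
    fixed-abd (Fixes-132 (Replaces⇒Fixes (there (there (here refl))) adq))
  split-ad adq (inj₁ (there (there (there (here refl))))) =
    clash (rearrange u (2F ∷ 1F ∷ 3F ∷ 0F ∷ []))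
          (Fixes-132 (Replaces⇒Fixes (there (there (here refl))) adq)) acb
  split-ad adq (inj₂ v) = let s , bds = rule (apart v 3F 1F) in split-bd v adq bds (locate s v)

-- The rule for a b makes the triple a b c fixed, so a c or b c reading from outside the triple is a
-- clash. Otherwise either one of these two pairs reads from itself, the mixed case, or all three
-- pairs read from their third position, the cyclic case.
outside⇒31≡22 : {f g : Vec A (4 + r) → B} → TotallySymmetric f → Replaceable f g →
                ∀ {a b c} → Unique (a ∷ b ∷ c ∷ []) → Replaces f g a b c → 31≡22 f
outside⇒31≡22 {f = f} {g} f-sym rule {a} {b} {c} u abc =
  let q , acq = rule (apart u 0F 2F) in split-ac acq (locate q u)
  where
  d,v : ∃ λ d → Unique (d ∷ a ∷ b ∷ c ∷ [])
  d,v = fresh u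

  v : Unique (proj₁ d,v ∷ a ∷ b ∷ c ∷ [])
  v = proj₂ d,v

  abc-fixed : Fixes f g a b c
  abc-fixed = Replaces⇒Fixes (there (there (here refl))) abc

  mixed-ac : Replaces f g a c a → 31≡22 f
  mixed-ac aca = mixed⇒31≡22 f-sym rule (rearrange v (0F ∷ 1F ∷ 3F ∷ 2F ∷ [])) aca abc

  mixed-bc : Replaces f g b c b → 31≡22 f
  mixed-bc bcb = mixed⇒31≡22 f-sym rule (rearrange v (0F ∷ 2F ∷ 3F ∷ 1F ∷ [])) bcb
                   (Replaces-sym f-sym (apart u 0F 1F) abc)

  split-bc : ∀ {s} → Replaces f g a c b → Replaces f g b c s →
             Any (s ≡_) (a ∷ b ∷ c ∷ []) ⊎ Unique (s ∷ a ∷ b ∷ c ∷ []) → 31≡22 f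
  split-bc acb bcs (inj₁ (here refl))                 = cyclic⇒31≡22 f-sym rule v abc acb bcs
  split-bc acb bcs (inj₁ (there (here refl)))         = mixed-bc bcs
  split-bc acb bcs (inj₁ (there (there (here refl)))) = mixed-bc (Replaces-end {f = f} {g} bcs)
  split-bc acb bcs (inj₂ w) =
    Fixes∧Replaces⇒31≡22 f-sym (rearrange w (0F ∷ 2F ∷ 3F ∷ 1F ∷ [])) (Fixes-231 abc-fixed) bcs

  split-ac : ∀ {q} → Replaces f g a c q →
             Any (q ≡_) (a ∷ b ∷ c ∷ []) ⊎ Unique (q ∷ a ∷ b ∷ c ∷ []) → 31≡22 f
  split-ac acq (inj₁ (here refl))                 = mixed-ac acq
  split-ac acq (inj₁ (there (here refl)))         =
    let s , bcs = rule (apart u 1F 2F) in split-bc acq bcs (locate s u)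
  split-ac acq (inj₁ (there (there (here refl)))) = mixed-ac (Replaces-end {f = f} {g} acq)
  split-ac acq (inj₂ w) =
    Fixes∧Replaces⇒31≡22 f-sym (rearrange w (0F ∷ 1F ∷ 3F ∷ 2F ∷ [])) (Fixes-132 abc-fixed) acq

-- Absorbing a replacement

-- Overwriting one of three copies of x with y is the passage from x x x y to x x y y.
31≡22⇒absorbs₁ : {f : Vec A (4 + r) → B} → TotallySymmetric f → 31≡22 f →
                 ∀ {i j k q} → Unique (i ∷ j ∷ k ∷ q ∷ []) → ∀ b →
                 lookup b i ≡ lookup b j → lookup b i ≡ lookup b k →
                 f (b [ i ]≔ lookup b q) ≡ f b
31≡22⇒absorbs₁ {f = f} f-sym h₃₁ {i} {j} {k} {q} u b bᵢ≡bⱼ bᵢ≡bₖ =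
  let xs , M , h = extract f-sym u b in go xs M h (transfers h 0F 1F bᵢ≡bⱼ) (transfers h 0F 2F bᵢ≡bₖ)
  where
  go : ∀ xs M → Holds f (i ∷ j ∷ k ∷ q ∷ []) b xs M → lookup xs 0F ≡ lookup xs 1F →
       lookup xs 0F ≡ lookup xs 2F → f (b [ i ]≔ lookup b q) ≡ f b
  go (x ∷ _ ∷ _ ∷ y ∷ []) M h refl refl = begin
    f (b [ i ]≔ lookup b q)  ≡⟨ copies h 0F 3F ⟩
    f (y ∷ x ∷ x ∷ y ∷ M)    ≡⟨ swap-front {f = f} f-sym 0F 2F (y ∷ x ∷ x ∷ y ∷ []) M ⟩
    f (x ∷ x ∷ y ∷ y ∷ M)    ≡⟨ h₃₁ x y M ⟨
    f (x ∷ x ∷ x ∷ y ∷ M)    ≡⟨ agrees h 0F ⟨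
    f b                      ∎

-- Overwriting an x in x x y y with y gives three copies of y and one x, which is `31≡22` with x and
-- y exchanged.
31≡22⇒absorbs₂ : {f : Vec A (4 + r) → B} → TotallySymmetric f → 31≡22 f →
                 ∀ {i j q k} → Unique (i ∷ j ∷ q ∷ k ∷ []) → ∀ b →
                 lookup b i ≡ lookup b j → lookup b q ≡ lookup b k →
                 f (b [ i ]≔ lookup b q) ≡ f b
31≡22⇒absorbs₂ {f = f} f-sym h₃₁ {i} {j} {q} {k} u b bᵢ≡bⱼ b_q≡bₖ =
  let xs , M , h = extract f-sym u b in go xs M h (transfers h 0F 1F bᵢ≡bⱼ) (transfers h 2F 3F b_q≡bₖ)
  where
  go : ∀ xs M → Holds f (i ∷ j ∷ q ∷ k ∷ []) b xs M → lookup xs 0F ≡ lookup xs 1F →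
       lookup xs 2F ≡ lookup xs 3F → f (b [ i ]≔ lookup b q) ≡ f b
  go (x ∷ _ ∷ y ∷ _ ∷ []) M h refl refl = begin
    f (b [ i ]≔ lookup b q)  ≡⟨ copies h 0F 2F ⟩
    f (y ∷ x ∷ y ∷ y ∷ M)    ≡⟨ swap-front {f = f} f-sym 1F 3F (y ∷ x ∷ y ∷ y ∷ []) M ⟩
    f (y ∷ y ∷ y ∷ x ∷ M)    ≡⟨ h₃₁ y x M ⟩
    f (y ∷ y ∷ x ∷ x ∷ M)    ≡⟨ swap-front {f = f} f-sym 0F 2F (y ∷ y ∷ x ∷ x ∷ []) M ⟩
    f (x ∷ y ∷ y ∷ x ∷ M)    ≡⟨ swap-front {f = f} f-sym 1F 3F (x ∷ y ∷ y ∷ x ∷ []) M ⟩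
    f (x ∷ x ∷ y ∷ y ∷ M)    ≡⟨ agrees h 0F ⟨
    f b                      ∎

-- A repeated value z elsewhere mediates: z z x x y and z z y y x both have the value of z z z x y
-- under f.
31≡22⇒absorbs₃ : {f : Vec A (4 + r) → B} → TotallySymmetric f → 31≡22 f →
                 ∀ {s t i j q} → Unique (s ∷ t ∷ i ∷ j ∷ q ∷ []) → ∀ b →
                 lookup b i ≡ lookup b j → lookup b s ≡ lookup b t →
                 f (b [ i ]≔ lookup b q) ≡ f b
31≡22⇒absorbs₃ {r = zero}  f-sym h₃₁ u b _ _ = contradiction u ¬unique-five
31≡22⇒absorbs₃ {r = suc r} {f = f} f-sym h₃₁ {s} {t} {i} {j} {q} u b bᵢ≡bⱼ bₛ≡bₜ =
  let xs , M , h = extract f-sym u b in go xs M h (transfers h 2F 3F bᵢ≡bⱼ) (transfers h 0F 1F bₛ≡bₜ)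
  where
  go : ∀ xs M → Holds f (s ∷ t ∷ i ∷ j ∷ q ∷ []) b xs M → lookup xs 2F ≡ lookup xs 3F →
       lookup xs 0F ≡ lookup xs 1F → f (b [ i ]≔ lookup b q) ≡ f b
  go (z ∷ _ ∷ x ∷ _ ∷ y ∷ []) M h refl refl = begin
    f (b [ i ]≔ lookup b q)    ≡⟨ copies h 2F 4F ⟩
    f (z ∷ z ∷ y ∷ x ∷ y ∷ M)  ≡⟨ swap-front {f = f} f-sym 3F 4F (z ∷ z ∷ y ∷ x ∷ y ∷ []) M ⟩
    f (z ∷ z ∷ y ∷ y ∷ x ∷ M)  ≡⟨ h₃₁ z y (x ∷ M) ⟨
    f (z ∷ z ∷ z ∷ y ∷ x ∷ M)  ≡⟨ swap-front {f = f} f-sym 3F 4F (z ∷ z ∷ z ∷ y ∷ x ∷ []) M ⟩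
    f (z ∷ z ∷ z ∷ x ∷ y ∷ M)  ≡⟨ h₃₁ z x (y ∷ M) ⟩
    f (z ∷ z ∷ x ∷ x ∷ y ∷ M)  ≡⟨ agrees h 0F ⟨
    f b                        ∎

repeat-avoiding : {k : ℕ} → A ↔ Fin k → k ℕ.< n → (b : Vec A (suc n)) (i : Fin (suc n)) →
                  ∃₂ λ s t → Unique (s ∷ i ∷ []) × Unique (t ∷ s ∷ i ∷ []) × lookup b s ≡ lookup b t
repeat-avoiding A↔k k<n b i
  with s , t , s<t , eq ← pigeonhole k<n (Inverse.to A↔k ∘ lookup b ∘ punchIn i) =
    punchIn i s , punchIn i t , s∷i ,
    (<⇒≢ s<t ∘ sym ∘ punchIn-injective i t s ∷ punchInᵢ≢i i t ∷ []) ∷ s∷i ,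
    Injection.injective (↔⇒↣ A↔k) eq
  where
  s∷i : ∀ {s} → Unique (punchIn i s ∷ i ∷ [])
  s∷i = (punchInᵢ≢i i _ ∷ []) ∷ [] ∷ []

-- Among the entries other than the one at i some value repeats, at s and t. If one of s, t is j or
-- q, the equality triples the value at i, doubles the value at q, or makes the overwriting trivial;
-- if neither is, the separate pair s t mediates.
31≡22⇒absorbs : {f : Vec A (4 + r) → B} {k : ℕ} → A ↔ Fin k → k ℕ.< 3 + r →
                TotallySymmetric f → 31≡22 f → ∀ {i j q} → Unique (q ∷ i ∷ j ∷ []) → ∀ b →
                lookup b i ≡ lookup b j → f (b [ i ]≔ lookup b q) ≡ f b
31≡22⇒absorbs {f = f} A↔k k<3+r f-sym h₃₁ {i} {j} {q} u b bᵢ≡bⱼ =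
  let s , t , s∷i , t∷s∷i , bₛ≡bₜ = repeat-avoiding A↔k k<3+r b i
  in split-s s∷i t∷s∷i bₛ≡bₜ (locate s u)
  where
  with-j : ∀ {s} → Unique (s ∷ q ∷ i ∷ j ∷ []) → lookup b s ≡ lookup b j →
           f (b [ i ]≔ lookup b q) ≡ f b
  with-j v bₛ≡bⱼ = 31≡22⇒absorbs₁ f-sym h₃₁ (rearrange v (2F ∷ 3F ∷ 0F ∷ 1F ∷ [])) b
                     bᵢ≡bⱼ (trans bᵢ≡bⱼ (sym bₛ≡bⱼ))

  with-q : ∀ {s} → Unique (s ∷ q ∷ i ∷ j ∷ []) → lookup b s ≡ lookup b q →
           f (b [ i ]≔ lookup b q) ≡ f b
  with-q v bₛ≡b_q = 31≡22⇒absorbs₂ f-sym h₃₁ (rearrange v (2F ∷ 3F ∷ 1F ∷ 0F ∷ [])) b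
                      bᵢ≡bⱼ (sym bₛ≡b_q)

  j-with-q : lookup b j ≡ lookup b q → f (b [ i ]≔ lookup b q) ≡ f b
  j-with-q bⱼ≡b_q = trans (cong (λ x → f (b [ i ]≔ x)) (sym (trans bᵢ≡bⱼ bⱼ≡b_q)))
                          (cong f ([]≔-lookup b i))

  split-t : ∀ {s t} → Unique (s ∷ q ∷ i ∷ j ∷ []) → Unique (t ∷ s ∷ i ∷ []) → lookup b s ≡ lookup b t →
            Any (t ≡_) (s ∷ q ∷ i ∷ j ∷ []) ⊎ Unique (t ∷ s ∷ q ∷ i ∷ j ∷ []) →
            f (b [ i ]≔ lookup b q) ≡ f b
  split-t v t∷s∷i eq (inj₁ (here refl))                         = contradiction refl (apart t∷s∷i 0F 1F)
  split-t v t∷s∷i eq (inj₁ (there (here refl)))                 = with-q v eq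
  split-t v t∷s∷i eq (inj₁ (there (there (here refl))))         = contradiction refl (apart t∷s∷i 0F 2F)
  split-t v t∷s∷i eq (inj₁ (there (there (there (here refl))))) = with-j v eq
  split-t v t∷s∷i eq (inj₂ w) =
    31≡22⇒absorbs₃ f-sym h₃₁ (rearrange w (1F ∷ 0F ∷ 3F ∷ 4F ∷ 2F ∷ [])) b bᵢ≡bⱼ eq

  split-s : ∀ {s t} → Unique (s ∷ i ∷ []) → Unique (t ∷ s ∷ i ∷ []) → lookup b s ≡ lookup b t →
            Any (s ≡_) (q ∷ i ∷ j ∷ []) ⊎ Unique (s ∷ q ∷ i ∷ j ∷ []) →
            f (b [ i ]≔ lookup b q) ≡ f b
  split-s {t = t} s∷i t∷s∷i eq (inj₁ (here refl)) with locate t u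
  ... | inj₁ (here refl)                 = contradiction refl (apart t∷s∷i 0F 1F)
  ... | inj₁ (there (here refl))         = contradiction refl (apart t∷s∷i 0F 2F)
  ... | inj₁ (there (there (here refl))) = j-with-q (sym eq)
  ... | inj₂ v                           = with-q v (sym eq)
  split-s s∷i t∷s∷i eq (inj₁ (there (here refl))) = contradiction refl (apart s∷i 0F 1F)
  split-s {t = t} s∷i t∷s∷i eq (inj₁ (there (there (here refl)))) with locate t u
  ... | inj₁ (here refl)                 = j-with-q eq
  ... | inj₁ (there (here refl))         = contradiction refl (apart t∷s∷i 0F 2F)
  ... | inj₁ (there (there (here refl))) = contradiction refl (apart t∷s∷i 0F 1F)
  ... | inj₂ v                           = with-j v (sym eq)
  split-s {t = t} s∷i t∷s∷i eq (inj₂ v) = split-t v t∷s∷i eq (locate t v)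

-- Reading the deck

toℕ-punchIn-< : (j : Fin (suc n)) (k : Fin n) → toℕ k ℕ.< toℕ j → toℕ (punchIn j k) ≡ toℕ k
toℕ-punchIn-< (suc j) zero    _         = refl
toℕ-punchIn-< (suc j) (suc k) (s≤s k<j) = cong suc (toℕ-punchIn-< j k k<j)

δ-< : (I : Pair (suc n)) {i : Fin (suc n)} → i < max I → toℕ (δ I i) ≡ toℕ i
δ-< I {i} i<max with <-cmp i (max I)
... | tri< _ _ _    = toℕ-fromℕ< _
... | tri≈ i≮max _ _ = contradiction i<max i≮max
... | tri> i≮max _ _ = contradiction i<max i≮max

δ-> : (I : Pair (suc n)) {i : Fin n} → max I < suc i → δ I (suc i) ≡ i
δ-> I {i} i>max with <-cmp (suc i) (max I)
... | tri< _ _ i≯max = contradiction i>max i≯max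
... | tri≈ _ _ i≯max = contradiction i>max i≯max
... | tri> _ _ _    = refl

δ-max : (I : Pair (suc n)) → toℕ (δ I (max I)) ≡ toℕ (min I)
δ-max I with <-cmp (max I) (max I)
... | tri< _ i≢i _ = contradiction refl i≢i
... | tri≈ _ _ _   = toℕ-fromℕ< _
... | tri> _ i≢i _ = contradiction refl i≢i

-- With `δ-punchIn` this describes `punchIn (max I) ∘ δ I`: it moves `max I` to `min I` and every
-- other position to itself.
punchIn-δ-max : (I : Pair (suc n)) → punchIn (max I) (δ I (max I)) ≡ min I
punchIn-δ-max I = toℕ-injective (trans
  (toℕ-punchIn-< (max I) (δ I (max I)) (subst (ℕ._< toℕ (max I)) (sym (δ-max I)) (min<max I)))
  (δ-max I))

-- For j the maximum of a pair, the two cases match the branches of `δ` below and above the maximum.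
punchIn-view : (j : Fin (suc n)) (k : Fin n) →
               (punchIn j k < j × toℕ (punchIn j k) ≡ toℕ k) ⊎ (j < punchIn j k × punchIn j k ≡ suc k)
punchIn-view zero    k       = inj₂ (s≤s z≤n , refl)
punchIn-view (suc j) zero    = inj₁ (s≤s z≤n , refl)
punchIn-view (suc j) (suc k) with punchIn-view j k
... | inj₁ (k<j , eq) = inj₁ (s≤s k<j , cong suc eq)
... | inj₂ (j<k , eq) = inj₂ (s≤s j<k , cong suc eq)

δ-punchIn : (I : Pair (suc n)) (k : Fin n) → δ I (punchIn (max I) k) ≡ k
δ-punchIn I k with punchIn-view (max I) k
... | inj₁ (k<max , eq) = toℕ-injective (trans (δ-< I k<max) eq)
... | inj₂ (max<k , eq) = trans (cong (δ I) eq) (δ-> I (subst (max I <_) eq max<k))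

-- A permutation relating the minors f_I and g_J extends to one of the original
-- positions sending max I to max J.
minors⇒Replaces : {f g : Vec A (suc n) → B} → TotallySymmetric f → (I J : Pair (suc n)) →
                  minor f I ≈ minor g J → ∃ λ q → Replaces f g (max J) (min J) q
minors⇒Replaces {n = n} {f = f} {g} f-sym I J (σ , f_I≈g_J) = q , replaces
  where
  -- The position of b whose entry is the one that `δ I` duplicates, traced back through σ and the
  -- removal of `max J`.
  q : Fin (suc n)
  q = punchIn (max J) (σ ⟨$⟩ˡ δ I (max I))

  π : Permutation′ (suc n)
  π = insert (max I) (max J) (flip σ)

  replaces : Replaces f g (max J) (min J) q
  replaces b b-max≡b-min = begin
    g b                                      ≡⟨ cong g (lookup-extensional c⊙δ) ⟨
    g (c ⊙ δ J)                              ≡⟨ cong (λ v → g (v ⊙ δ J)) (⊙-flip c σ) ⟨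
    g ((a ⊙ (σ ⟨$⟩ʳ_)) ⊙ δ J)                ≡⟨ f_I≈g_J a ⟨
    f (a ⊙ δ I)                              ≡⟨ cong f (lookup-extensional a⊙δ) ⟩
    f (b′ ⊙ (π ⟨$⟩ʳ_))                       ≡⟨ f-sym b′ π ⟨
    f b′                                     ∎
    where
    -- c drops the entry of b at `max J`, which `δ J` restores from the equal one at `min J`; a is
    -- chosen so that reordering it by σ gives c.
    c = b ⊙ punchIn (max J)
    a = c ⊙ (flip σ ⟨$⟩ʳ_)
    b′ = b [ max J ]≔ lookup b q

    c⊙δ : ∀ i → lookup (c ⊙ δ J) i ≡ lookup b i
    c⊙δ i = trans (lookup-⊙ c (δ J) i) (trans (lookup-⊙ b (punchIn (max J)) (δ J i)) (at (max J ≟ i)))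
      where
      at : ∀ {i} → Dec (max J ≡ i) → lookup b (punchIn (max J) (δ J i)) ≡ lookup b i
      at     (yes refl) = trans (cong (lookup b) (punchIn-δ-max J)) (sym b-max≡b-min)
      at {i} (no J≢i)   = cong (lookup b) (begin
        punchIn (max J) (δ J i)
          ≡⟨ cong (punchIn (max J) ∘ δ J) (punchIn-punchOut J≢i) ⟨
        punchIn (max J) (δ J (punchIn (max J) (punchOut J≢i)))
          ≡⟨ cong (punchIn (max J)) (δ-punchIn J (punchOut J≢i)) ⟩
        punchIn (max J) (punchOut J≢i)
          ≡⟨ punchIn-punchOut J≢i ⟩
        i ∎)

    a⊙δ : ∀ i → lookup (a ⊙ δ I) i ≡ lookup (b′ ⊙ (π ⟨$⟩ʳ_)) i
    a⊙δ i = begin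
      lookup (a ⊙ δ I) i                              ≡⟨ lookup-⊙ a (δ I) i ⟩
      lookup a (δ I i)                                ≡⟨ lookup-⊙ c (flip σ ⟨$⟩ʳ_) (δ I i) ⟩
      lookup c (σ ⟨$⟩ˡ δ I i)                         ≡⟨ lookup-⊙ b (punchIn (max J)) (σ ⟨$⟩ˡ δ I i) ⟩
      lookup b (punchIn (max J) (σ ⟨$⟩ˡ δ I i))       ≡⟨ at (max I ≟ i) ⟩
      lookup b′ (π ⟨$⟩ʳ i)                            ≡⟨ lookup-⊙ b′ (π ⟨$⟩ʳ_) i ⟨
      lookup (b′ ⊙ (π ⟨$⟩ʳ_)) i                       ∎
      where
      at-punchIn : ∀ k → lookup b (punchIn (max J) (σ ⟨$⟩ˡ δ I (punchIn (max I) k))) ≡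
                         lookup b′ (π ⟨$⟩ʳ punchIn (max I) k)
      at-punchIn k = begin
        lookup b (punchIn (max J) (σ ⟨$⟩ˡ δ I (punchIn (max I) k)))
          ≡⟨ cong (λ l → lookup b (punchIn (max J) (σ ⟨$⟩ˡ l))) (δ-punchIn I k) ⟩
        lookup b (punchIn (max J) (σ ⟨$⟩ˡ k))
          ≡⟨ lookup∘update′ (punchInᵢ≢i (max J) (σ ⟨$⟩ˡ k)) b (lookup b q) ⟨
        lookup b′ (punchIn (max J) (σ ⟨$⟩ˡ k))
          ≡⟨ cong (lookup b′) (insert-punchIn (max I) (max J) (flip σ) k) ⟨
        lookup b′ (π ⟨$⟩ʳ punchIn (max I) k) ∎

      at : ∀ {i} → Dec (max I ≡ i) →
           lookup b (punchIn (max J) (σ ⟨$⟩ˡ δ I i)) ≡ lookup b′ (π ⟨$⟩ʳ i)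
      at (no I≢i)   = subst (λ i → lookup b (punchIn (max J) (σ ⟨$⟩ˡ δ I i)) ≡ lookup b′ (π ⟨$⟩ʳ i))
                        (punchIn-punchOut I≢i) (at-punchIn (punchOut I≢i))
      at (yes refl) = sym (trans (cong (lookup b′) (insert-image (max I) (max J) (flip σ)))
                                 (lookup∘update (max J) b (lookup b q)))

-- The bijection of the decks is used backwards, so that every pair J for g is reached from some
-- pair for f.
reconstruction⇒Replaces : {f g : Vec A (suc n) → B} → TotallySymmetric f →
                          g IsReconstructionOf f → (J : Pair (suc n)) →
                          ∃ λ q → Replaces f g (max J) (min J) q
reconstruction⇒Replaces {f = f} {g} f-sym (π , f≈g) J = minors⇒Replaces f-sym (Inverse.from π J) J
  (subst (λ K → minor f (Inverse.from π J) ≈ minor g K) (Inverse.inverseˡ π refl) (f≈g _))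

reconstruction⇒Replaceable : {f g : Vec A (2 + r) → B} → TotallySymmetric f →
                             g IsReconstructionOf f → Replaceable f g
reconstruction⇒Replaceable f-sym rec {i} {j} i≢j with <-cmp i j
... | tri< i<j _ _ = let q , jiq = reconstruction⇒Replaces f-sym rec (pair i j i<j)
                     in q , Replaces-sym f-sym (i≢j ∘ sym) jiq
... | tri≈ _ i≡j _ = contradiction i≡j i≢j
... | tri> _ _ j<i = reconstruction⇒Replaces f-sym rec (pair j i j<i)

-- Agreement of f with its reconstructions

-- Ensures n to be at least 4, the number of positions that the case analysis starts from.
card≥2 : {k : ℕ} → AtLeastTwo A → A ↔ Fin k → 2 ℕ.≤ k
card≥2 {k = zero}        (x , _ , _)   A↔k with () ← Inverse.to A↔k x
card≥2 {k = suc zero}    (x , y , x≢y) A↔k =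
  contradiction (Injection.injective (↔⇒↣ A↔k) (all-equal (Inverse.to A↔k x) (Inverse.to A↔k y))) x≢y
  where
  all-equal : (i j : Fin 1) → i ≡ j
  all-equal zero zero = refl
card≥2 {k = suc (suc k)} _             _   = s≤s (s≤s z≤n)

-- With more positions than values, b has equal entries at some i and j, so g b is f of b after a
-- replacement. The replacement is trivial if it reads from i or j, and otherwise its very existence
-- yields `31≡22`, which absorbs it.
reconstruction-agrees : {f g : Vec A (4 + r) → B} {k : ℕ} → A ↔ Fin k → k ℕ.< 3 + r →
                        TotallySymmetric f → g IsReconstructionOf f → ∀ b → f b ≡ g b
reconstruction-agrees {f = f} {g} A↔k k<3+r f-sym rec b
  with i , j , i<j , bᵢ≡bⱼ ← pigeonhole (ℕ.m<n⇒m<1+n k<3+r) (Inverse.to A↔k ∘ lookup b)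
  with i≢j ← <⇒≢ i<j
  with q , ijq ← reconstruction⇒Replaceable {f = f} {g} f-sym rec i≢j
  = agree (locate q ((i≢j ∷ []) ∷ [] ∷ []))
  where
  repeated : lookup b i ≡ lookup b j
  repeated = Injection.injective (↔⇒↣ A↔k) bᵢ≡bⱼ

  kept : Any (q ≡_) (i ∷ j ∷ []) → lookup b q ≡ lookup b i
  kept (here refl)         = refl
  kept (there (here refl)) = sym repeated

  absorbed : Any (q ≡_) (i ∷ j ∷ []) ⊎ Unique (q ∷ i ∷ j ∷ []) → f (b [ i ]≔ lookup b q) ≡ f b
  absorbed (inj₁ q∈) = trans (cong (λ x → f (b [ i ]≔ x)) (kept q∈)) (cong f ([]≔-lookup b i))
  absorbed (inj₂ u)  = 31≡22⇒absorbs A↔k k<3+r f-sym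
    (outside⇒31≡22 f-sym (reconstruction⇒Replaceable {f = f} {g} f-sym rec) (rearrange u (1F ∷ 2F ∷ 0F ∷ [])) ijq)
    u b repeated

  agree : Any (q ≡_) (i ∷ j ∷ []) ⊎ Unique (q ∷ i ∷ j ∷ []) → f b ≡ g b
  agree c = sym (trans (ijq b repeated) (absorbed c))

theorem5p1 : ∀ {a b} {A : Set a} {B : Set b} →
    AtLeastTwo A → AtLeastTwo B →
    (k n : ℕ) → A ↔ Fin k → n ≥ k + 2 →
    (f : Vec A n → B) → TotallySymmetric f → Reconstructible f
theorem5p1 A≥2 _ k n A↔k n≥k+2 f f-sym g rec
  with r , refl ← ℕ.m≤n⇒∃[o]m+o≡n (ℕ.≤-trans (ℕ.+-monoˡ-≤ 2 (card≥2 A≥2 A↔k)) n≥k+2) =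
  -- Reindexing by the identity is `tabulate (lookup 𝐚)`, which is equal to 𝐚 only propositionally.
  Perm.id , λ 𝐚 → trans (reconstruction-agrees {f = f} {g} A↔k k<3+r f-sym rec 𝐚)
                        (cong g (sym (tabulate∘lookup 𝐚)))
  where
  k<3+r : k ℕ.< 3 + r
  -- From 2 + k at most 4 + r one successor is cancelled; the other turns the bound into a strict
  -- one, which leaves room to drop a position before the pigeonhole argument.
  k<3+r = ℕ.s≤s⁻¹ (subst (ℕ._≤ 4 + r) (ℕ.+-comm k 2) n≥k+2)
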